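{- If $G$ is a wheel-free graph on at least two vertices, then $G$ has at least two vertices of degree at most $3$.
   Context: Graphs are finite, simple and undirected. A graph $G$ is wheel-free if it contains no wheel as a subgraph, i.e. there is no cycle $C$ of $G$ (as a subgraph, not necessarily induced) and vertex $v\in V(G)\setminus V(C)$ such that $v$ has at least three neighbors in $V(C)$. -}

module Defs where

open import Data.Fin.Base using (Fin)
open import Data.List.Base using (List; _∷_; _∷ʳ_; length; filter; allFin)
open import Data.List.Membership.Propositional using (_∈_; _∉_)
open import Data.List.Relation.Unary.Linked using (Linked)
open import Data.List.Relation.Unary.Unique.Propositional using (Unique)
open import Data.Nat.Base using (ℕ; _≤_)
open import Level using (0ℓ)
open import Relation.Binary.Core using (Rel)
open import Relation.Binary.Definitions using (Symmetric; Irreflexive; Decidable)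
open import Relation.Binary.PropositionalEquality.Core using (_≡_; _≢_)
open import Relation.Nullary.Negation.Core using (¬_)

-- A finite graph is a decidable relation on Fin n, so that, as in classical
-- finite combinatorics, any two vertices are adjacent or not and degrees are
-- numbers.
record Graph (n : ℕ) : Set₁ where
  infix 4 _~_ _~?_
  field
    _~_      : Rel (Fin n) 0ℓ
    ~-sym    : Symmetric _~_
    ~-irrefl : Irreflexive _≡_ _~_
    _~?_     : Decidable _~_

  neighbours : Fin n → List (Fin n)
  neighbours v = filter (v ~?_) (allFin n)

  degree : Fin n → ℕ
  degree v = length (neighbours v)

  -- The cycle x, x₁, …, xₖ, x, where rest = x₁, …, xₖ.  The bound k ≥ 2
  -- excludes single edges traversed back and forth; chords are allowed.
  record Cycle : Set where
    field
      start : Fin n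
      rest  : List (Fin n)

    vertices : List (Fin n)
    vertices = start ∷ rest

    field
      long     : 2 ≤ length rest
      distinct : Unique vertices
      linked   : Linked _~_ (vertices ∷ʳ start)

  record Wheel : Set where
    field
      rim : Cycle
      hub : Fin n

    open Cycle rim using (vertices)

    field
      hub∉rim : hub ∉ vertices
      a b c   : Fin n
      a∈rim   : a ∈ vertices
      b∈rim   : b ∈ vertices
      c∈rim   : c ∈ vertices
      a≢b     : a ≢ b
      a≢c     : a ≢ c
      b≢c     : b ≢ c
      hub~a   : hub ~ a
      hub~b   : hub ~ b
      hub~c   : hub ~ c

  WheelFree : Set
  WheelFree = ¬ Wheel

{-# OPTIONS --safe #-}
module Submission where

-- Grow a set K inducing a 2-connected subgraph, starting from a single vertex, such that every
-- vertex of the remaining set R has four neighbours in K ∪ R.  An ear P of K inside R may be added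
-- to K as long as R ∖ P still contains a cycle.  When no ear can be added there is a wheel: if
-- every vertex of R has at most one neighbour in K, then for any ear P a leaf of the forest R ∖ P
-- is the hub and P closed up through K is the rim; if some vertex of R has two neighbours in K,
-- then R contains a vertex with exactly two neighbours in R, and it is the hub of a wheel whose
-- rim is formed by the rest of a cycle in R and a path in K.  If there is no ear at all, then a
-- component of R is attached to the rest at one vertex, which restarts the argument on fewer
-- vertices.  Everything happens under the goal ⊥, so that reasoning by cases is available; the
-- theorem itself follows because its conclusion is decidable.

open import Defs
open import Data.Empty using (⊥; ⊥-elim)
open import Data.Fin.Base using (Fin; zero; suc)
open import Data.Fin.Properties using (_≟_; any?; injective⇒≤)
open import Data.List.Base using (List; []; _∷_; _++_; _∷ʳ_; length; lookup; allFin)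
open import Data.List.Membership.Propositional using (_∈_; _∉_)
open import Data.List.Membership.Propositional.Properties
  using (∈-++⁺ˡ; ∈-++⁺ʳ; ∈-++⁻; ∈-lookup)
open import Data.List.Properties using (∷ʳ-++)
open import Data.List.Relation.Binary.Disjoint.Propositional using (Disjoint)
open import Data.List.Relation.Unary.All as All using (All; []; _∷_)
import Data.List.Relation.Unary.All.Properties as All
open import Data.List.Relation.Unary.AllPairs as AllPairs using ([]; _∷_)
open import Data.List.Relation.Unary.Any using (here; there)
open import Data.List.Relation.Unary.Linked using (Linked; [-]; _∷_)
open import Data.List.Relation.Unary.Unique.Propositional using (Unique)
import Data.List.Relation.Unary.Unique.Propositional.Properties as Unique
open import Data.Nat.Base using (ℕ; zero; suc; _+_; _≤_; z≤n; s≤s; s≤s⁻¹)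
open import Data.Nat.Properties using (≤-refl; ≰⇒>; ≤⇒≯; +-suc; +-comm; _≤?_; m≤m+n)
open import Data.Product.Base using (_×_; _,_; ∃; ∃₂; proj₁; proj₂)
open import Data.Sum.Base as Sum using (_⊎_; inj₁; inj₂)
open import Data.Unit.Base using (⊤)
open import Function.Base using (_∘_; id; case_of_)
open import Level using (0ℓ)
open import Relation.Binary.PropositionalEquality.Core
  using (_≡_; _≢_; refl; sym; trans; cong; subst; ≢-sym)
open import Relation.Nullary using (¬_; yes; no)
open import Relation.Nullary.Decidable using (decidable-stable; ¬?; _×-dec_)
open import Relation.Unary using (Pred; _∪_; _⊆_)

-- Lists without repetition.

module _ {A : Set} where

  unique-++⁻ : ∀ (xs : List A) {ys} → Unique (xs ++ ys) →
               Unique xs × Unique ys × Disjoint xs ys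
  unique-++⁻ [] ys! = [] , ys! , λ ()
  unique-++⁻ (x ∷ xs) (x∉ ∷ xs++ys!) with unique-++⁻ xs xs++ys!
  ... | xs! , ys! , xs#ys =
    All.++⁻ˡ xs x∉ ∷ xs! , ys! ,
    λ where
      (here refl , y∈ys) → All.lookup (All.++⁻ʳ xs x∉) y∈ys refl
      (there x∈xs , x∈ys) → xs#ys (x∈xs , x∈ys)

  lookup-injective : ∀ {xs : List A} → Unique xs → ∀ {i j} → lookup xs i ≡ lookup xs j → i ≡ j
  lookup-injective (_ ∷ _) {zero} {zero} _ = refl
  lookup-injective (x∉ ∷ _) {zero} {suc j} eq = ⊥-elim (All.lookup x∉ (∈-lookup j) eq)
  lookup-injective (x∉ ∷ _) {suc i} {zero} eq = ⊥-elim (All.lookup x∉ (∈-lookup i) (sym eq))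
  lookup-injective (_ ∷ xs!) {suc i} {suc j} eq = cong suc (lookup-injective xs! eq)

  cons-unique : ∀ {x : A} {xs} → x ∉ xs → Unique xs → Unique (x ∷ xs)
  cons-unique x∉ xs! = All.¬Any⇒All¬ _ x∉ ∷ xs!

unique-length≤n : ∀ {n} {xs : List (Fin n)} → Unique xs → length xs ≤ n
unique-length≤n xs! = injective⇒≤ (lookup-injective xs!)

infixl 6 _−_
_−_ : ∀ {A : Set} → Pred A 0ℓ → A → Pred A 0ℓ
(S − y) x = S x × x ≢ y

module _ {n : ℕ} (G : Graph n) where

  open Graph G
  open import Data.List.Membership.DecPropositional (_≟_ {n}) using (_∈?_)

  private
    V : Set
    V = Fin n

  ~⇒≢ : ∀ {u v} → u ~ v → u ≢ v
  ~⇒≢ u~v refl = ~-irrefl refl u~v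

  -- Walks, paths and circuits.

  data Walk : V → V → List V → Set where
    stop : ∀ {u} → Walk u u (u ∷ [])
    step : ∀ {u w v xs} → u ~ w → Walk w v xs → Walk u v (u ∷ xs)

  head∈ : ∀ {u v xs} → Walk u v xs → u ∈ xs
  head∈ stop = here refl
  head∈ (step _ _) = here refl

  last∈ : ∀ {u v xs} → Walk u v xs → v ∈ xs
  last∈ stop = here refl
  last∈ (step _ p) = there (last∈ p)

  join : ∀ {u v w t xs ys} → Walk u v xs → v ~ w → Walk w t ys → Walk u t (xs ++ ys)
  join stop v~w q = step v~w q
  join (step u~u′ p) v~w q = step u~u′ (join p v~w q)

  -- `xs` leaves out `x`, so that the pieces of a walk cut at `x` can be reassembled without
  -- repeating it. A `Walk` never has an empty list, hence the extra alternative.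
  Before After : V → V → List V → Set
  Before u x xs = (u ≡ x × xs ≡ []) ⊎ ∃ λ p → Walk u p xs × p ~ x
  After x v xs = (x ≡ v × xs ≡ []) ⊎ ∃ λ q → x ~ q × Walk q v xs

  Before⇒Walk : ∀ {u x xs} → Before u x xs → Walk u x (xs ∷ʳ x)
  Before⇒Walk (inj₁ (refl , refl)) = stop
  Before⇒Walk (inj₂ (_ , p , p~x)) = join p p~x stop

  After⇒Walk : ∀ {x v xs} → After x v xs → Walk x v (x ∷ xs)
  After⇒Walk (inj₁ (refl , refl)) = stop
  After⇒Walk (inj₂ (_ , x~q , q)) = step x~q q

  split : ∀ {u v x xs} → Walk u v xs → x ∈ xs →
          ∃₂ λ as bs → xs ≡ as ++ x ∷ bs × Before u x as × After x v bs
  split stop (here refl) = [] , [] , refl , inj₁ (refl , refl) , inj₁ (refl , refl)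
  split (step u~w p) (here refl) = [] , _ , refl , inj₁ (refl , refl) , inj₂ (_ , u~w , p)
  split (step u~w p) (there x∈) with split p x∈
  ... | as , bs , refl , inj₁ (refl , refl) , af = _ , bs , refl , inj₂ (_ , stop , u~w) , af
  ... | as , bs , refl , inj₂ (_ , q , q~x) , af = _ , bs , refl , inj₂ (_ , step u~w q , q~x) , af

  module _ (S : Pred V 0ℓ) where

    data Reach : V → V → Set where
      here  : ∀ {u} → S u → Reach u u
      there : ∀ {u w v} → S u → u ~ w → Reach w v → Reach u v

    record Path (u v : V) : Set where
      constructor path
      field
        {list} : List V
        walk   : Walk u v list
        unique : Unique list
        inside : All S list

    -- `c` is singled out together with its two neighbours `s` and `t` on the circuit; `s≢t` forces
    -- a length of at least three.
    record Circuit : Set where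
      constructor circuit
      field
        {c s t} : V
        {rest}  : List V
        c~s     : c ~ s
        walk    : Walk s t rest
        t~c     : t ~ c
        s≢t     : s ≢ t
        unique  : Unique (c ∷ rest)
        inside  : All S (c ∷ rest)

  -- `S` may be undecidable, so neighbours are exhibited one by one; deleting each from `S` keeps
  -- them distinct.
  data AtLeast (S : Pred V 0ℓ) : ℕ → V → Set where
    none : ∀ {v} → AtLeast S zero v
    more : ∀ {k v y} → v ~ y → S y → AtLeast (S − y) k v → AtLeast S (suc k) v

  module _ {S : Pred V 0ℓ} where

    reach-source : ∀ {u v} → Reach S u v → S u
    reach-source (here Su) = Su
    reach-source (there Su _ _) = Su

    reach-target : ∀ {u v} → Reach S u v → S v
    reach-target (here Sv) = Sv
    reach-target (there _ _ r) = reach-target r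

    reach-trans : ∀ {u v w} → Reach S u v → Reach S v w → Reach S u w
    reach-trans (here _) r = r
    reach-trans (there Su u~x q) r = there Su u~x (reach-trans q r)

    reach-sym : ∀ {u v} → Reach S u v → Reach S v u
    reach-sym (here Su) = here Su
    reach-sym (there Su u~w r) =
      reach-trans (reach-sym r) (there (reach-source r) (~-sym u~w) (here Su))

    reach⇒path : ∀ {u v} → Reach S u v → Path S u v
    reach⇒path (here Su) = path stop ([] ∷ []) (Su ∷ [])
    reach⇒path {u} (there Su u~w r) with reach⇒path r
    ... | path {xs} p xs! Sxs with u ∈? xs
    ... | no u∉ = path (step u~w p) (cons-unique u∉ xs!) (Su ∷ Sxs)
    ... | yes u∈ with split p u∈
    ... | as , bs , refl , _ , af =
      path (After⇒Walk af) (proj₁ (proj₂ (unique-++⁻ as xs!))) (All.++⁻ʳ as Sxs)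

    walk⇒reach : ∀ {u v xs} → Walk u v xs → All S xs → Reach S u v
    walk⇒reach stop (Su ∷ []) = here Su
    walk⇒reach (step u~w p) (Su ∷ Sxs) = there Su u~w (walk⇒reach p Sxs)

    head-reaches : ∀ {u v x xs} → Walk u v xs → All S xs → x ∈ xs → Reach S u x
    head-reaches p Sxs x∈ with split p x∈
    ... | as , bs , refl , be , _ =
      walk⇒reach (Before⇒Walk be)
        (All.++⁺ (All.++⁻ˡ as Sxs) (All.head (All.++⁻ʳ as Sxs) ∷ []))

    reaches-last : ∀ {u v x xs} → Walk u v xs → All S xs → x ∈ xs → Reach S x v
    reaches-last p Sxs x∈ with split p x∈
    ... | as , bs , refl , _ , af = walk⇒reach (After⇒Walk af) (All.++⁻ʳ as Sxs)

    -- Used with `Q` a path to be rerouted: the stretch returned avoids `Q`, so it can be spliced in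
    -- without repetition.
    first-hit : ∀ {y t} (Q : List V) → Reach S y t → y ∉ Q → t ∈ Q →
                ∃₂ λ z q → q ∈ Q × S q × z ~ q × Reach (λ x → S x × x ∉ Q) y z
    first-hit Q (here _) y∉ t∈ = ⊥-elim (y∉ t∈)
    first-hit Q (there {w = w} Sy y~w r) y∉ t∈ with w ∈? Q
    ... | yes w∈ = _ , w , w∈ , reach-source r , y~w , here (Sy , y∉)
    ... | no w∉ with first-hit Q r w∉ t∈
    ... | z , q , q∈ , Sq , z~q , r′ = z , q , q∈ , Sq , z~q , there (Sy , y∉) y~w r′

  module _ {S T : Pred V 0ℓ} (S⊆T : S ⊆ T) where

    reach-mono : ∀ {u v} → Reach S u v → Reach T u v
    reach-mono (here Su) = here (S⊆T Su)
    reach-mono (there Su u~w r) = there (S⊆T Su) u~w (reach-mono r)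

  atLeast-mono : ∀ {S T : Pred V 0ℓ} {k v} → (∀ {x} → v ~ x → S x → T x) →
                 AtLeast S k v → AtLeast T k v
  atLeast-mono S⊆T none = none
  atLeast-mono S⊆T (more v~y Sy r) =
    more v~y (S⊆T v~y Sy) (atLeast-mono (λ v~x (Sx , x≢y) → S⊆T v~x Sx , x≢y) r)

  atLeast-≤ : ∀ {S : Pred V 0ℓ} {j k v} → j ≤ k → AtLeast S k v → AtLeast S j v
  atLeast-≤ z≤n _ = none
  atLeast-≤ (s≤s j≤k) (more v~y Sy r) = more v~y Sy (atLeast-≤ j≤k r)

  atLeast-− : ∀ {S : Pred V 0ℓ} {v} y k → AtLeast S (suc k) v → AtLeast (S − y) k v
  atLeast-− y zero _ = none
  atLeast-− y (suc k) (more {y = x} v~x Sx r) with x ≟ y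
  ... | yes refl = r
  ... | no x≢y = more v~x (Sx , x≢y)
    (atLeast-mono (λ _ ((Sz , z≢x) , z≢y) → (Sz , z≢y) , z≢x) (atLeast-− y k r))

  ∪-− : ∀ (S T : Pred V 0ℓ) {x y} → ((S ∪ T) − y) x → ((S − y) ∪ (T − y)) x
  ∪-− S T (inj₁ Sx , x≢y) = inj₁ (Sx , x≢y)
  ∪-− S T (inj₂ Tx , x≢y) = inj₂ (Tx , x≢y)

  -- Each neighbour found in `S` counts towards `k`; each one found in `T` uses up one of the at
  -- most `j` allowed there. The upper bound is a refuted `AtLeast`, as `T` may be undecidable.
  atLeast-∪ : ∀ {S T : Pred V 0ℓ} {v} j k → AtLeast (S ∪ T) (j + k) v →
              ¬ AtLeast T (suc j) v → AtLeast S k v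
  atLeast-∪ j zero _ _ = none
  atLeast-∪ {S} {T} {v} j (suc k) many few
    with subst (λ m → AtLeast (S ∪ T) m v) (+-suc j k) many
  ... | more v~y (inj₁ Sy) r =
    more v~y Sy
      (atLeast-∪ j k (atLeast-mono (λ _ → ∪-− S T) r) (few ∘ atLeast-mono {T − _} (λ _ → proj₁)))
  atLeast-∪ zero (suc k) _ few | more v~y (inj₂ Ty) _ = ⊥-elim (few (more v~y Ty none))
  atLeast-∪ {S} {T} {v} (suc j) (suc k) _ few | more {y = y} v~y (inj₂ Ty) r =
    atLeast-mono (λ _ → proj₁)
      (atLeast-∪ j (suc k)
        (atLeast-mono (λ _ → ∪-− S T)
          (subst (λ m → AtLeast ((S ∪ T) − y) m v) (sym (+-suc j k)) r))
        (few ∘ more v~y Ty))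

  list⇒atLeast : ∀ {S : Pred V 0ℓ} {v} {xs} → Unique xs → All (v ~_) xs → All S xs →
                 AtLeast S (length xs) v
  list⇒atLeast [] [] [] = none
  list⇒atLeast (x∉ ∷ xs!) (v~x ∷ v~xs) (Sx ∷ Sxs) =
    more v~x Sx (list⇒atLeast xs! v~xs (All.zipWith (λ (Sy , x≢y) → Sy , ≢-sym x≢y) (Sxs , x∉)))

  atMostOne⇒≡ : ∀ {S : Pred V 0ℓ} {v x y} → ¬ AtLeast S 2 v →
                v ~ x → S x → v ~ y → S y → x ≡ y
  atMostOne⇒≡ {x = x} {y} few v~x Sx v~y Sy = decidable-stable (x ≟ y)
    λ x≢y → few (more v~x Sx (more v~y (Sy , ≢-sym x≢y) none))

  -- Circuits read as cycles of the graph, and their rotation.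

  linked : ∀ {x u v y xs} → x ~ u → Walk u v xs → v ~ y → Linked _~_ (x ∷ xs ∷ʳ y)
  linked x~u stop v~y = x~u ∷ v~y ∷ [-]
  linked x~u (step u~w p) v~y = x~u ∷ linked u~w p v~y

  long : ∀ {u v xs} → Walk u v xs → u ≢ v → 2 ≤ length xs
  long stop u≢u = ⊥-elim (u≢u refl)
  long (step _ stop) _ = s≤s (s≤s z≤n)
  long (step _ (step _ _)) _ = s≤s (s≤s z≤n)

  rotate : ∀ {S x} (C : Circuit S) → x ∈ Circuit.c C ∷ Circuit.rest C →
           ∃ λ (C′ : Circuit S) → Circuit.c C′ ≡ x
  rotate C (here refl) = C , refl
  rotate {S} {x} (circuit {c} {s} {t} c~s p t~c s≢t c∷ys! Sc∷ys) (there x∈) with split p x∈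
  ... | as , bs , refl , be , af with unique-++⁻ (c ∷ as) c∷ys!
  ... | c∷as! , x∷bs! , c∷as#x∷bs = rotated be af
    where
    unique : Unique (x ∷ bs ++ c ∷ as)
    unique = Unique.++⁺ x∷bs! c∷as! λ (y∈ , y∈′) → c∷as#x∷bs (y∈′ , y∈)

    inside : All S (x ∷ bs ++ c ∷ as)
    inside = All.++⁺ (All.++⁻ʳ (c ∷ as) Sc∷ys) (All.++⁻ˡ (c ∷ as) Sc∷ys)

    to-x : Before s x as → ∃ λ z → Walk c z (c ∷ as) × z ~ x
    to-x (inj₁ (refl , refl)) = c , stop , c~s
    to-x (inj₂ (z , q , z~x)) = z , step c~s q , z~x

    rotated : Before s x as → After x t bs → ∃ λ (C′ : Circuit S) → Circuit.c C′ ≡ x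
    rotated (inj₁ (s≡x , _)) (inj₁ (x≡t , _)) = ⊥-elim (s≢t (trans s≡x x≡t))
    rotated (inj₂ (z , q , z~x)) (inj₁ (refl , refl)) =
      circuit t~c (step c~s q) z~x
        (λ c≡z → All.lookup (AllPairs.head c∷as!) (last∈ q) c≡z) unique inside , refl
    rotated be (inj₂ (w , x~w , q)) with to-x be
    ... | z , r , z~x =
      circuit x~w (join q t~c r) z~x
        (λ w≡z → c∷as#x∷bs (last∈ r , there (subst (_∈ bs) w≡z (head∈ q)))) unique inside , refl

  -- Leaves of forests.

  -- Extend a path at its end u for as long as possible; it only gets stuck by closing a circuit.
  -- A path that starts at e never meets e again, and otherwise e has no neighbour in A.
  module _ {A : Pred V 0ℓ} (acyclic : ¬ Circuit A) (e : V)
           (branching : ∀ x → A x → x ≢ e → ¬ ¬ AtLeast A 2 x) where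

    private
      grow : ∀ fuel {u t xs} → suc n ≤ fuel + length xs → Walk u t xs → Unique xs → All A xs →
             u ≢ e → e ∈ xs ⊎ (∀ x → A x → x ~ e → ¬ A e) → ⊥
      -- Out of fuel, the path would have more than `n` distinct vertices.
      grow zero n<len _ xs! _ _ _ = ≤⇒≯ (unique-length≤n xs!) n<len
      grow (suc fuel) {u} {xs = xs} n<len p xs! Axs u≢e avoid =
        branching u Au u≢e (extend p)
        where
        Au : A u
        Au = All.lookup Axs (head∈ p)

        avoids : ∀ {y} → e ∈ xs ⊎ (∀ x → A x → x ~ e → ¬ A e) → u ~ y → A y → y ∉ xs → y ≢ e
        avoids (inj₁ e∈) _ _ y∉ refl = y∉ e∈
        avoids (inj₂ isolated) u~e Ae _ refl = isolated u Au u~e Ae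

        append : ∀ {y} → u ~ y → A y → y ∉ xs → ⊥
        append u~y Ay y∉ =
          grow fuel (subst (suc n ≤_) (sym (+-suc fuel _)) n<len)
            (step (~-sym u~y) p) (cons-unique y∉ xs!) (Ay ∷ Axs) (avoids avoid u~y Ay y∉)
            (Sum.map₁ there avoid)

        close : ∀ {w t ys y} → xs ≡ u ∷ ys → u ~ w → Walk w t ys → y ≢ w → u ~ y → y ∈ ys → ⊥
        close {y = y} refl u~w q y≢w u~y y∈ with split q y∈
        ... | as , bs , refl , be , _ =
          acyclic (circuit u~w (Before⇒Walk be) (~-sym u~y) (≢-sym y≢w)
            (proj₁ (unique-++⁻ (u ∷ as ∷ʳ y) (subst Unique eq xs!)))
            (All.++⁻ˡ (u ∷ as ∷ʳ y) (subst (All A) eq Axs)))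
          where eq = cong (u ∷_) (sym (∷ʳ-++ as y bs))

        extend-to : ∀ {w t ys y} → xs ≡ u ∷ ys → u ~ w → Walk w t ys → y ≢ w → u ~ y → A y → ⊥
        extend-to {ys = ys} {y} refl u~w q y≢w u~y Ay with y ∈? ys
        ... | yes y∈ = close refl u~w q y≢w u~y y∈
        ... | no y∉ = append u~y Ay λ where
          (here refl) → ~-irrefl refl u~y
          (there y∈) → y∉ y∈

        extend : ∀ {t} → Walk u t xs → AtLeast A 2 u → ⊥
        extend stop (more u~y Ay _) = append u~y Ay λ where (here refl) → ~-irrefl refl u~y
        -- One of the two neighbours differs from `w`; it lengthens the path or closes a circuit.
        extend (step {w = w} u~w q) (more {y = y} u~y Ay (more u~z (Az , z≢y) _)) with y ≟ w
        ... | no y≢w = extend-to refl u~w q y≢w u~y Ay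
        ... | yes refl = extend-to refl u~w q z≢y u~z Az

    -- The existence of a leaf other than `e`, in contrapositive form: each use passes its
    -- refutation of a leaf as `branching`, so that no degree within `A` has to be decided.
    forest-leaf : ∀ {w} → A w → w ≢ e → ⊥
    forest-leaf {w} Aw w≢e =
      grow n (subst (suc n ≤_) (+-comm 1 n) ≤-refl) stop ([] ∷ []) (Aw ∷ []) w≢e
        -- If `e` does have a neighbour `x` in `A`, a second run starts from the path `x`, `e` and
        -- grows it at `x`.
        (inj₂ λ x Ax x~e Ae →
          grow n (subst (suc n ≤_) (sym (+-suc n 1)) (m≤m+n (suc n) 1))
            (step x~e stop) ((~⇒≢ x~e ∷ []) ∷ [] ∷ []) (Ax ∷ Ae ∷ []) (~⇒≢ x~e)
            (inj₁ (there (here refl))))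

  -- Two-connected sets and ears.

  -- A `w` outside `K` yields connectedness of `K` itself. Single vertices qualify, so the
  -- construction can start from a point.
  Biconnected : Pred V 0ℓ → Set
  Biconnected K = ∀ w {u v} → (K − w) u → (K − w) v → Reach (K − w) u v

  Through : Pred V 0ℓ → V → V → V → Set
  Through K a b h = ∃ λ (p : Path K a b) → h ∈ Path.list p

  -- To reroute an a-b path via w through the next vertex y, leave y in K − w until the path is
  -- met again, say at q, and replace the stretch between q and w.
  through-step : ∀ {K a b w y} → Biconnected K → K a → K b → a ≢ b →
                 Through K a b w → w ~ y → K y → Through K a b y
  through-step {K} {a} {b} {w} {y} K-bic Ka Kb a≢b (path {xs} p xs! Kxs , w∈) w~y Ky
    with y ∈? xs
  ... | yes y∈ = path p xs! Kxs , y∈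
  ... | no y∉ = detour end
    where
    -- The detour aims at an end of the path other than `w`, which exists because `a ≢ b`.
    end : ∃ λ t → t ∈ xs × (K − w) t
    end with a ≟ w
    ... | no a≢w = a , head∈ p , Ka , a≢w
    ... | yes refl = b , last∈ p , Kb , ≢-sym a≢b

    detour : (∃ λ t → t ∈ xs × (K − w) t) → Through K a b y
    detour (t , t∈ , Kt)
      with first-hit xs (K-bic w (Ky , ≢-sym (~⇒≢ w~y)) Kt) y∉ t∈ | split p w∈
    ... | z , q , q∈ , (_ , q≢w) , z~q , r | as , bs , refl , be , af
      with ∈-++⁻ as q∈ | unique-++⁻ as xs!
    ... | inj₂ (here q≡w) | _ = ⊥-elim (q≢w q≡w)
    ... | inj₁ q∈as | as! , wbs! , as#wbs = left be
      where
      left : Before a w as → Through K a b y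
      left (inj₁ (_ , refl)) = case q∈as of λ ()
      left (inj₂ (_ , p₁ , _)) with split p₁ q∈as | reach⇒path (reach-sym r)
      ... | as₁ , as₂ , refl , be₁ , _ | path {zs} d zs! Kzs
        with subst Unique (sym (∷ʳ-++ as₁ q as₂)) as!
      ... | as!′ =
        path (join (Before⇒Walk be₁) (~-sym z~q) (join d (~-sym w~y) (After⇒Walk af)))
          (Unique.++⁺ (proj₁ (unique-++⁻ (as₁ ∷ʳ q) as!′))
            (Unique.++⁺ zs! wbs! λ (x∈zs , x∈) →
              proj₂ (All.lookup Kzs x∈zs) (∈-++⁺ʳ as x∈))
            λ (x∈ , x∈′) → case ∈-++⁻ zs x∈′ of λ where
              (inj₁ x∈zs) → proj₂ (All.lookup Kzs x∈zs) (∈-++⁺ˡ (⊆as x∈))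
              (inj₂ x∈wbs) → as#wbs (⊆as x∈ , x∈wbs))
          (All.++⁺ (All.++⁻ˡ (as₁ ∷ʳ q) (subst (All K) (sym (∷ʳ-++ as₁ q as₂)) (All.++⁻ˡ as Kxs)))
            (All.++⁺ (All.map (proj₁ ∘ proj₁) Kzs) (All.++⁻ʳ as Kxs)))
        , ∈-++⁺ʳ (as₁ ∷ʳ q) (∈-++⁺ˡ (last∈ d))
        where
        ⊆as : ∀ {x} → x ∈ as₁ ∷ʳ q → x ∈ as
        ⊆as x∈ = subst (_ ∈_) (∷ʳ-++ as₁ q as₂) (∈-++⁺ˡ x∈)
    ... | inj₂ (there q∈bs) | _ = right af
      where
      xs≡ : as ++ w ∷ bs ≡ as ∷ʳ w ++ bs
      xs≡ = sym (∷ʳ-++ as w bs)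

      right : After w b bs → Through K a b y
      right (inj₁ (_ , refl)) = case q∈bs of λ ()
      right (inj₂ (_ , _ , p₁))
        with split p₁ q∈bs | reach⇒path r | unique-++⁻ (as ∷ʳ w) (subst Unique xs≡ xs!)
      ... | bs₁ , bs₂ , refl , _ , af₁ | path {zs} d zs! Kzs | asw! , bs! , asw#bs =
        path (join (Before⇒Walk be) w~y (join d z~q (After⇒Walk af₁)))
          (Unique.++⁺ asw!
            (Unique.++⁺ zs! (proj₁ (proj₂ (unique-++⁻ bs₁ bs!))) λ (x∈zs , x∈) →
              proj₂ (All.lookup Kzs x∈zs) (bs⊆ (∈-++⁺ʳ bs₁ x∈)))
            λ (x∈ , x∈′) → case ∈-++⁻ zs x∈′ of λ where
              (inj₁ x∈zs) → proj₂ (All.lookup Kzs x∈zs) (subst (_ ∈_) (sym xs≡) (∈-++⁺ˡ x∈))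
              (inj₂ x∈bs) → asw#bs (x∈ , ∈-++⁺ʳ bs₁ x∈bs))
          (All.++⁺ (All.++⁻ˡ (as ∷ʳ w) (subst (All K) xs≡ Kxs))
            (All.++⁺ (All.map (proj₁ ∘ proj₁) Kzs)
              (All.++⁻ʳ bs₁ (All.++⁻ʳ (as ∷ʳ w) (subst (All K) xs≡ Kxs)))))
        , ∈-++⁺ʳ (as ∷ʳ w) (∈-++⁺ˡ (head∈ d))
        where
        bs⊆ : ∀ {x} → x ∈ bs → x ∈ as ++ w ∷ bs
        bs⊆ x∈ = ∈-++⁺ʳ as (there x∈)

  through-reach : ∀ {K a b w h} → Biconnected K → K a → K b → a ≢ b →
                  Through K a b w → Reach K w h → Through K a b h
  through-reach K-bic Ka Kb a≢b thr (here _) = thr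
  through-reach K-bic Ka Kb a≢b thr (there _ w~y r) =
    through-reach K-bic Ka Kb a≢b
      (through-step K-bic Ka Kb a≢b thr w~y (reach-source r)) r

  -- Lying on some path from `a` to `b` holds for `a` and spreads along edges of `K` by
  -- `through-step`. That `K` is connected comes from deleting `o`, which lies outside it.
  biconnected⇒through : ∀ {K a b h o} → Biconnected K → ¬ K o → K a → K b → a ≢ b → K h →
                        Through K a b h
  biconnected⇒through {K} {o = o} K-bic ¬Ko Ka Kb a≢b Kh =
    through-reach K-bic Ka Kb a≢b (a-b , head∈ (Path.walk a-b)) (reach Ka Kh)
    where
    reach : ∀ {u v} → K u → K v → Reach K u v
    reach Ku Kv = reach-mono proj₁
      (K-bic o (Ku , λ where refl → ¬Ko Ku) (Kv , λ where refl → ¬Ko Kv))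

    a-b = reach⇒path (reach Ka Kb)

  -- If `w` lies on the ear, each of the two remaining pieces hangs on `a` or `b`; otherwise the
  -- whole ear hangs on an end different from `w`. If both ends are `w`, then `K` is that vertex
  -- alone and only the ear is left.
  biconnected-ear : ∀ {K a b r t xs} → Biconnected K → K a → K b →
                    a ≢ b ⊎ (∀ {k} → K k → k ≡ a) →
                    Walk r t xs → Unique xs → (∀ {x} → x ∈ xs → ¬ K x) → a ~ r → t ~ b →
                    Biconnected (K ∪ (_∈ xs))
  biconnected-ear {K} {a} {b} {r} {t} {xs} K-bic Ka Kb ends p xs! xs∩K a~r t~b w = connected
    where
    K⁺ = (K ∪ (_∈ xs)) − w

    xs⊆K⁺ : w ∉ xs → All K⁺ xs
    xs⊆K⁺ w∉ = All.tabulate λ x∈ → inj₂ x∈ , λ where refl → w∉ x∈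

    connected-via-K : (∀ {u} → u ∈ xs → u ≢ w → ∃ λ k → (K − w) k × Reach K⁺ u k) →
                      ∀ {u v} → K⁺ u → K⁺ v → Reach K⁺ u v
    connected-via-K anchor Ku Kv with anchored Ku | anchored Kv
      where
      anchored : ∀ {u} → K⁺ u → ∃ λ k → (K − w) k × Reach K⁺ u k
      anchored (inj₁ Ku , u≢w) = _ , (Ku , u≢w) , here (inj₁ Ku , u≢w)
      anchored (inj₂ u∈ , u≢w) = anchor u∈ u≢w
    ... | k , Kk , u⇝k | l , Kl , v⇝l =
      reach-trans u⇝k
        (reach-trans (reach-mono (λ (Kx , x≢w) → inj₁ Kx , x≢w) (K-bic w Kk Kl))
          (reach-sym v⇝l))

    via-a : ∀ {u} → a ≢ w → Reach K⁺ r u → ∃ λ k → (K − w) k × Reach K⁺ u k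
    via-a a≢w r⇝u =
      a , (Ka , a≢w) , reach-sym (there (inj₁ Ka , a≢w) a~r r⇝u)

    via-b : ∀ {u} → b ≢ w → Reach K⁺ u t → ∃ λ k → (K − w) k × Reach K⁺ u k
    via-b b≢w u⇝t =
      b , (Kb , b≢w) , reach-trans u⇝t (there (reach-target u⇝t) t~b (here (inj₁ Kb , b≢w)))

    connected : ∀ {u v} → K⁺ u → K⁺ v → Reach K⁺ u v
    connected with w ∈? xs
    ... | yes w∈ with split p w∈
    ... | as , bs , refl , be , af with unique-++⁻ as xs!
    ... | as! , w∉bs ∷ _ , as#wbs = connected-via-K λ u∈ u≢w → anchor (∈-++⁻ as u∈) u≢w be af
      where
      ≢w : ∀ {k} → K k → k ≢ w
      ≢w Kk refl = xs∩K w∈ Kk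

      anchor : ∀ {u} → u ∈ as ⊎ u ∈ w ∷ bs → u ≢ w → Before r w as → After w t bs →
               ∃ λ k → (K − w) k × Reach K⁺ u k
      anchor (inj₁ u∈) _ (inj₁ (_ , refl)) _ = case u∈ of λ ()
      anchor (inj₁ u∈) _ (inj₂ (_ , q , _)) _ = via-a (≢w Ka)
        (head-reaches q (All.tabulate λ x∈ →
          inj₂ (∈-++⁺ˡ x∈) , λ where refl → as#wbs (x∈ , here refl)) u∈)
      anchor (inj₂ (here u≡w)) u≢w _ _ = ⊥-elim (u≢w u≡w)
      anchor (inj₂ (there u∈)) _ _ (inj₁ (_ , refl)) = case u∈ of λ ()
      anchor (inj₂ (there u∈)) _ _ (inj₂ (_ , _ , q)) = via-b (≢w Kb)
        (reaches-last q (All.tabulate λ x∈ →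
          inj₂ (∈-++⁺ʳ as (there x∈)) , ≢-sym (All.lookup w∉bs x∈)) u∈)
    connected | no w∉ with a ≟ w | b ≟ w
    ... | no a≢w | _ = connected-via-K λ u∈ _ → via-a a≢w (head-reaches p (xs⊆K⁺ w∉) u∈)
    ... | yes _ | no b≢w = connected-via-K λ u∈ _ → via-b b≢w (reaches-last p (xs⊆K⁺ w∉) u∈)
    ... | yes refl | yes b≡a = λ Ku Kv → reach-trans (reach-sym (from-r ends Ku)) (from-r ends Kv)
      where
      from-r : ∀ {u} → a ≢ b ⊎ (∀ {k} → K k → k ≡ a) → K⁺ u → Reach K⁺ r u
      from-r (inj₁ a≢b) _ = ⊥-elim (a≢b (sym b≡a))
      from-r (inj₂ K⊆a) (inj₁ Ku , u≢w) = ⊥-elim (u≢w (K⊆a Ku))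
      from-r (inj₂ _) (inj₂ u∈ , _) =
        head-reaches p (xs⊆K⁺ w∉) u∈

  -- Wheels and the set-up of the induction.

  module _ (wheelFree : WheelFree) where

    noHub : ∀ {S h} (C : Circuit S) (let open Circuit C) → h ∉ c ∷ rest →
            AtLeast (_∈ c ∷ rest) 3 h → ⊥
    noHub {h = h} (circuit c~s p t~c s≢t unique _) h∉
      (more h~x x∈ (more h~y (y∈ , y≢x) (more h~z ((z∈ , z≢x) , z≢y) _))) =
      wheelFree record
        { rim = record { long = long p s≢t ; distinct = unique ; linked = linked c~s p t~c }
        ; hub = h ; hub∉rim = h∉
        ; a∈rim = x∈ ; b∈rim = y∈ ; c∈rim = z∈
        ; a≢b = ≢-sym y≢x ; a≢c = ≢-sym z≢x ; b≢c = ≢-sym z≢y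
        ; hub~a = h~x ; hub~b = h~y ; hub~c = h~z }

    -- Rims are glued from a path in `R` and a path in `K`. The latter may be a single vertex, so
    -- `s ≢ t` is what guarantees three vertices.
    noHub-joined : ∀ {s t a b h xs ys} → Walk s t xs → s ≢ t → t ~ a → Walk a b ys → b ~ s →
                   Unique xs → Unique ys → Disjoint xs ys →
                   h ∉ xs ++ ys → AtLeast (_∈ xs ++ ys) 3 h → ⊥
    noHub-joined stop s≢s _ _ _ _ _ _ = ⊥-elim (s≢s refl)
    noHub-joined (step s~w p) _ t~a q b~s xs! ys! xs#ys =
      noHub {S = λ _ → ⊤}
        (circuit s~w (join p t~a q) b~s (λ where refl → xs#ys (there (head∈ p) , last∈ q))
          (Unique.++⁺ xs! ys! xs#ys) (All.universal _ _))

    -- `R` may be undecidable and so cannot be enumerated; its size is bounded through its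
    -- repetition-free lists.
    Size≤ : ℕ → Pred V 0ℓ → Set
    Size≤ m R = ∀ {xs} → Unique xs → All R xs → length xs ≤ m

    size-shrink : ∀ {m y} {R S : Pred V 0ℓ} → Size≤ (suc m) R → R y → S ⊆ R − y → Size≤ m S
    size-shrink size Ry S⊆ xs! Sxs =
      s≤s⁻¹ (size (All.map (λ Sx → ≢-sym (proj₂ (S⊆ Sx))) Sxs ∷ xs!)
                  (Ry ∷ All.map (proj₁ ∘ S⊆) Sxs))

    record Setup (K R : Pred V 0ℓ) : Set where
      field
        K-bic    : Biconnected K
        K∩R      : ∀ {x} → K x → ¬ R x
        degree≥4 : ∀ {v} → R v → AtLeast (K ∪ R) 4 v

      degree≥4′ : ∀ {v} → R v → AtLeast (R ∪ K) 4 v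
      degree≥4′ Rv = atLeast-mono (λ _ → Sum.swap) (degree≥4 Rv)

    -- The second alternative of `ends` admits an ear returning to its starting vertex, but only
    -- while `K` is that single vertex.
    record Ear (K R : Pred V 0ℓ) : Set where
      constructor ear
      field
        {a b r t} : V
        Ka    : K a
        Kb    : K b
        ends  : a ≢ b ⊎ (∀ {k} → K k → k ≡ a)
        a~r   : a ~ r
        inner : Path R r t
        t~b   : t ~ b
      open Path inner public

    infixl 6 _∖_
    _∖_ : Pred V 0ℓ → List V → Pred V 0ℓ
    (S ∖ xs) x = S x × x ∉ xs

    setup-ear : ∀ {K R} → Setup K R → (E : Ear K R) →
                Setup (K ∪ (_∈ Ear.list E)) (R ∖ Ear.list E)
    setup-ear {K} {R} setup (ear Ka Kb ends a~r (path {xs} p xs! Rxs) t~b) = record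
      { K-bic = biconnected-ear K-bic Ka Kb ends p xs!
                  (λ x∈ Kx → K∩R Kx (All.lookup Rxs x∈)) a~r t~b
      ; K∩R = λ where
          (inj₁ Kx) (Rx , _) → K∩R Kx Rx
          (inj₂ x∈) (_ , x∉) → x∉ x∈
      ; degree≥4 = λ (Rv , _) → atLeast-mono (λ _ → regroup) (degree≥4 Rv)
      }
      where
      open Setup setup

      regroup : ∀ {x} → (K ∪ R) x → ((K ∪ (_∈ xs)) ∪ (R ∖ xs)) x
      regroup (inj₁ Kx) = inj₁ (inj₁ Kx)
      regroup {x} (inj₂ Rx) with x ∈? xs
      ... | yes x∈ = inj₁ (inj₂ x∈)
      ... | no x∉ = inj₂ (Rx , x∉)

    -- Both are proved by one induction on `m`: `CircuitClaim` makes what an ear leaves of `R` a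
    -- forest, and `PointClaim` settles the case without ears.
    CircuitClaim PointClaim : ℕ → Set₁
    CircuitClaim m = ∀ {K R k} → Setup K R → K k → Size≤ m R → ¬ Circuit R
    PointClaim m = ∀ {R k r} → ¬ R k → R r → (∀ {v} → R v → AtLeast ((_≡ k) ∪ R) 4 v) →
                   Size≤ m R → ⊥

    -- An ear takes at least its first vertex out of `R`, so the claim for `m` applies to the rest.
    ear-acyclic : ∀ {m K R} → CircuitClaim m → Setup K R → Size≤ (suc m) R → (E : Ear K R) →
                  ¬ Circuit (R ∖ Ear.list E)
    ear-acyclic claim setup size E =
      claim (setup-ear setup E) (inj₁ Ka)
        (size-shrink size (All.lookup inside (head∈ walk))
          λ (Rx , x∉) → Rx , λ where refl → x∉ (head∈ walk))
      where open Ear E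

    -- Excluding ears when `R` is sparsely joined to `K`.

    -- A leaf of the forest R ∖ P has three neighbours on P ∪ K, at most one of them in K, so
    -- that P closes up through K to the rim of a wheel.
    module _ {m K R} (claim : CircuitClaim m) (setup : Setup K R) (size : Size≤ (suc m) R)
             (sparse : ∀ {v} → R v → ¬ AtLeast K 2 v) where

      open Setup setup

      private
        noSpareEar : ∀ {o} (E : Ear K R) (let open Ear E) → r ≢ t → R o → o ∉ list → ⊥
        noSpareEar {o} E@(ear {a} {b} {r} {t} Ka Kb ends a~r (path {xs} p xs! Rxs) t~b) r≢t Ro o∉ =
          -- The exceptional vertex `a` lies in `K`, hence outside the forest. A leaf has at most
          -- one of its four neighbours in the forest, so three in `K ∪ (_∈ xs)`.
          forest-leaf (ear-acyclic claim setup size E) a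
            (λ ℓ (Rℓ , ℓ∉) _ few → leaf Rℓ ℓ∉
              (atLeast-∪ 1 3 (Setup.degree≥4 (setup-ear setup E) (Rℓ , ℓ∉)) few))
            (Ro , o∉) λ where refl → K∩R Ka Ro
          where
          back : ∀ {h} → a ≢ b ⊎ (∀ {k} → K k → k ≡ a) → K h → Through K b a h
          back (inj₁ a≢b) Kh =
            biconnected⇒through K-bic (λ Ko → K∩R Ko Ro) Kb Ka (≢-sym a≢b) Kh
          back (inj₂ K⊆a) Kh with K⊆a Kb | K⊆a Kh
          ... | refl | refl = path stop ([] ∷ []) (Kh ∷ []) , here refl

          leaf : ∀ {ℓ} → R ℓ → ℓ ∉ xs → AtLeast (K ∪ (_∈ xs)) 3 ℓ → ⊥
          -- Whether `ℓ` has a neighbour in `K` is not decided: the rim first passes through `a`,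
          -- and once a neighbour `k` turns up, it is led through `k` instead.
          leaf {ℓ} Rℓ ℓ∉ three = via Ka λ Kk ℓ~k → ⊥-elim (via Kk λ Kk′ ℓ~k′ →
            atMostOne⇒≡ (sparse Rℓ) ℓ~k′ Kk′ ℓ~k Kk)
            where
            via : ∀ {h} → K h → (∀ {k} → K k → ℓ ~ k → k ≡ h) → ⊥
            via Kh only with back ends Kh
            ... | path {ys} q ys! Kys , h∈ =
              noHub-joined p r≢t t~b q a~r xs! ys!
                (λ (x∈ , x∈′) → K∩R (All.lookup Kys x∈′) (All.lookup Rxs x∈))
                (λ ℓ∈ → case ∈-++⁻ xs ℓ∈ of λ where
                  (inj₁ ℓ∈xs) → ℓ∉ ℓ∈xs
                  (inj₂ ℓ∈ys) → K∩R (All.lookup Kys ℓ∈ys) Rℓ)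
                (atLeast-mono (λ where
                    ℓ~x (inj₁ Kx) → ∈-++⁺ʳ xs (subst (_∈ ys) (sym (only Kx ℓ~x)) h∈)
                    _ (inj₂ x∈) → ∈-++⁺ˡ x∈)
                  three)

      -- If the ear uses up R, then a chord at its first vertex shortens it.
      noEar : (E : Ear K R) (let open Ear E) → r ≢ t → ⊥
      noEar (ear _ _ _ _ (path stop _ _) _) r≢r = r≢r refl
      noEar E@(ear Ka Kb ends a~r (path (step {w = w} r~w p) (r∉ ∷ xs!) (Rr ∷ Rxs)) t~b) r≢t
        -- Of four neighbours of `r` at most one is in `K` and one is `w`. If the remaining `y` is
        -- on the ear, going straight from `r` to `y` frees `w`.
        with atLeast-− w 2 (atLeast-∪ 1 3 (degree≥4′ Rr) (sparse Rr))
      ... | more {y = y} r~y (Ry , y≢w) _ with y ∈? Ear.list E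
      ... | no y∉ = noSpareEar E r≢t Ry y∉
      ... | yes (here refl) = ~-irrefl refl r~y
      ... | yes (there y∈) with split p y∈
      ... | _ , _ , refl , inj₁ (w≡y , _) , _ = y≢w (sym w≡y)
      ... | as , bs , refl , inj₂ (_ , q , _) , af with unique-++⁻ as xs!
      ... | _ , ybs! , as#ybs =
        noSpareEar
          (ear Ka Kb ends a~r
            (path (step r~y (After⇒Walk af)) (All.++⁻ʳ as r∉ ∷ ybs!) (Rr ∷ All.++⁻ʳ as Rxs)) t~b)
          r≢t (All.lookup Rxs (head∈ p)) λ where
            (here w≡r) → ~-irrefl (sym w≡r) r~w
            (there w∈) → as#ybs (head∈ q , w∈)

    circuit-avoid : ∀ {R z} (C : Circuit R) (let open Circuit C) → z ∉ c ∷ rest → Circuit (R − z)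
    circuit-avoid (circuit c~s p t~c s≢t unique inside) z∉ =
      circuit c~s p t~c s≢t unique
        (All.tabulate λ x∈ → All.lookup inside x∈ , λ where refl → z∉ x∈)

    -- Vertices of `R` with two neighbours in `K`.

    -- If z ∈ R has two neighbours in K, then R − z is acyclic and its leaf ℓ has exactly two
    -- neighbours in R.  Each of these has two neighbours in K, since R − ℓ is acyclic as well, so
    -- ℓ is the hub of a wheel.
    module _ {m K R} (claim : CircuitClaim m) (setup : Setup K R) (size : Size≤ (suc m) R)
             (C : Circuit R) where

      open Setup setup

      private
        -- Such a `z` is an ear by itself.
        acyclic : ∀ {z} → R z → AtLeast K 2 z → ¬ Circuit (R − z)
        acyclic Rz (more z~a Ka (more z~b (Kb , b≢a) _)) (circuit c~s p t~c s≢t unique inside) =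
          ear-acyclic claim setup size
            (ear Ka Kb (inj₁ (≢-sym b≢a)) (~-sym z~a) (path stop ([] ∷ []) (Rz ∷ [])) z~b)
            (circuit c~s p t~c s≢t unique
              (All.map (λ (Rx , x≢z) → Rx , λ where (here x≡z) → x≢z x≡z) inside))

        circuit-at : ∀ {z} → R z → AtLeast K 2 z → ∃ λ (C′ : Circuit R) → Circuit.c C′ ≡ z
        circuit-at {z} Rz two with z ∈? Circuit.c C ∷ Circuit.rest C
        ... | yes z∈ = rotate C z∈
        ... | no z∉ = ⊥-elim (acyclic Rz two (circuit-avoid C z∉))

        -- Otherwise `x` has three neighbours in `K`, so by `circuit-at` it lies on a circuit in
        -- `R`, which supplies two neighbours in `R` after all.
        branching : ∀ {x} → R x → ¬ ¬ AtLeast R 2 x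
        branching Rx few
          with circuit-at Rx (atLeast-≤ (s≤s (s≤s z≤n)) (atLeast-∪ 1 3 (degree≥4 Rx) few))
        ... | circuit c~s p t~c s≢t _ (_ ∷ Rys) , refl =
          few (more c~s (All.lookup Rys (head∈ p))
                (more (~-sym t~c) (All.lookup Rys (last∈ p) , ≢-sym s≢t) none))

        module _ {ℓ} (Rℓ : R ℓ) (≤2 : ¬ AtLeast R 3 ℓ) where

          two : AtLeast K 2 ℓ
          two = atLeast-∪ 2 2 (degree≥4 Rℓ) ≤2

          -- Otherwise `s` keeps two neighbours in `R − ℓ`. The vertices other than `s` and `t` lose
          -- none, being non-adjacent to `ℓ`, so the forest `R − ℓ` would have no leaf besides `t`.
          two-at : ∀ {s t} → ℓ ~ s → R s → ℓ ~ t → R t → s ≢ t → ¬ ¬ AtLeast K 2 s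
          two-at {s} {t} ℓ~s Rs ℓ~t Rt s≢t few =
            forest-leaf (acyclic Rℓ two) t still-branching (Rs , ≢-sym (~⇒≢ ℓ~s)) s≢t
            where
            still-branching : ∀ x → (R − ℓ) x → x ≢ t → ¬ ¬ AtLeast (R − ℓ) 2 x
            still-branching x (Rx , _) x≢t few′ with x ≟ s
            ... | yes refl = few′ (atLeast-− ℓ 2 (atLeast-∪ 1 3 (degree≥4′ Rs) few))
            ... | no x≢s = branching Rx λ twoR → few′ (atLeast-mono
              (λ where
                x~y Ry → Ry , λ where
                  refl → ≤2 (more ℓ~s Rs
                    (more ℓ~t (Rt , ≢-sym s≢t) (more (~-sym x~y) ((Rx , x≢s) , x≢t) none))))
              twoR)

          noLeaf : ⊥
          noLeaf with circuit-at Rℓ two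
          ... | circuit {s = s} {t} ℓ~s p t~ℓ s≢t (ℓ∉ ∷ ys!) (_ ∷ Rys) , refl =
            two-at ℓ~s Rs (~-sym t~ℓ) Rt s≢t λ two-s →
            two-at (~-sym t~ℓ) Rt ℓ~s Rs (≢-sym s≢t) λ two-t →
            wheel two two-s two-t
            where
            Rs = All.lookup Rys (head∈ p)
            Rt = All.lookup Rys (last∈ p)

            wheel : AtLeast K 2 ℓ → AtLeast K 2 s → AtLeast K 2 t → ⊥
            -- The rim runs from `s` to `t` along the circuit without `ℓ`, then from `a` through `h`
            -- to `b` in `K`; the hub `ℓ` sees `s`, `t` and `h`. One of the two neighbours of `s` in
            -- `K` differs from `a`.
            wheel (more ℓ~h Kh _) two-s (more {y = a} t~a Ka _) with atLeast-− a 1 two-s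
            ... | more s~b (Kb , b≢a) _
              with biconnected⇒through K-bic (λ Kℓ → K∩R Kℓ Rℓ) Ka Kb (≢-sym b≢a) Kh
            ... | path {zs} q zs! Kzs , h∈ =
              noHub-joined p s≢t t~a q (~-sym s~b) ys! zs!
                (λ (x∈ , x∈′) → K∩R (All.lookup Kzs x∈′) (All.lookup Rys x∈))
                (λ ℓ∈ → case ∈-++⁻ _ ℓ∈ of λ where
                  (inj₁ ℓ∈ys) → All.lookup ℓ∉ ℓ∈ys refl
                  (inj₂ ℓ∈zs) → K∩R (All.lookup Kzs ℓ∈zs) Rℓ)
                (more ℓ~s (∈-++⁺ˡ (head∈ p))
                  (more (~-sym t~ℓ) (∈-++⁺ˡ (last∈ p) , ≢-sym s≢t)
                    (more ℓ~h ((∈-++⁺ʳ _ h∈ , λ where refl → K∩R Kh Rs) , λ where refl → K∩R Kh Rt)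
                      none)))

      sparse : ∀ {z} → R z → ¬ AtLeast K 2 z
      sparse {z} Rz two-z with circuit-at Rz two-z
      ... | circuit c~s p _ _ _ (_ ∷ Rys) , refl =
        -- A leaf of `R − z` has at most two neighbours in `R`, since `z` adds at most one.
        forest-leaf (acyclic Rz two-z) z
          (λ ℓ (Rℓ , _) _ few → noLeaf Rℓ (few ∘ atLeast-− z 2))
          (All.lookup Rys (head∈ p) , ≢-sym (~⇒≢ c~s)) (≢-sym (~⇒≢ c~s))

    -- The induction on the size of `R`.

    connecting-path : ∀ {R u v w} → Reach R w u → Reach R w v → Path R u v
    connecting-path w⇝u w⇝v = reach⇒path (reach-trans (reach-sym w⇝u) w⇝v)

    -- By `noEar`, `k` has at most one neighbour `s` in the component `D`. The other vertices of `D`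
    -- are not adjacent to `k` and keep all their neighbours, so `s` can replace `k` and `D − s` can
    -- replace `R`.
    point-step : ∀ {m} → CircuitClaim m → PointClaim m → PointClaim (suc m)
    point-step {m} circuits points {R} {k} {r₀} ¬Rk Rr₀ degree≥4 size =
      -- If `k` has no neighbour in `D`, then `r₀` serves as `s`; once a neighbour `x` appears, `x`
      -- does.
      only (here Rr₀) λ Dx k~x → ⊥-elim (only Dx λ Dy k~y → same Dy k~y Dx k~x)
      where
      setup : Setup (_≡ k) R
      setup = record
        { K-bic = λ where w (refl , k≢w) (refl , _) → here (refl , k≢w)
        ; K∩R = λ where refl → ¬Rk
        ; degree≥4 = degree≥4
        }

      sparse-k : ∀ {v} → R v → ¬ AtLeast (_≡ k) 2 v
      sparse-k _ (more _ refl (more _ (refl , k≢k) _)) = k≢k refl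

      D = Reach R r₀

      same : ∀ {x y} → D x → k ~ x → D y → k ~ y → x ≡ y
      same {x} {y} Dx k~x Dy k~y = decidable-stable (x ≟ y) (noEar circuits setup size sparse-k
        (ear refl refl (inj₂ id) k~x (connecting-path Dx Dy) (~-sym k~y)))

      only : ∀ {s} → D s → (∀ {x} → D x → k ~ x → x ≡ s) → ⊥
      only {s} Ds unique
        with atLeast-∪ 1 3 (Setup.degree≥4′ setup (reach-target Ds)) (sparse-k (reach-target Ds))
      ... | more s~y Ry _ =
        points {D − s} {s} (λ (_ , s≢s) → s≢s refl)
          (extend Ds s~y Ry , ≢-sym (~⇒≢ s~y))
          (λ (Dv , v≢s) → atLeast-mono (regroup Dv v≢s) (degree≥4 (reach-target Dv)))
          (size-shrink size (reach-target Ds) λ (Dx , x≢s) → reach-target Dx , x≢s)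
        where
        extend : ∀ {v x} → D v → v ~ x → R x → D x
        extend Dv v~x Rx = reach-trans Dv (there (reach-target Dv) v~x (here Rx))

        regroup : ∀ {v x} → D v → v ≢ s → v ~ x → ((_≡ k) ∪ R) x → ((_≡ s) ∪ (D − s)) x
        regroup Dv v≢s v~k (inj₁ refl) = ⊥-elim (v≢s (unique Dv (~-sym v~k)))
        regroup {x = x} Dv v≢s v~x (inj₂ Rx) with x ≟ s
        ... | yes x≡s = inj₁ x≡s
        ... | no x≢s = inj₂ (extend Dv v~x Rx , x≢s)

    -- Edges from the component `D` to two vertices of `K` would give an ear, so `D` is attached to
    -- `K` at one vertex at most, which becomes the point.
    circuit-step : ∀ {m} → CircuitClaim m → PointClaim (suc m) → CircuitClaim (suc m)
    circuit-step {m} circuits points {K} {R} {k₀} setup Kk₀ size C =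
      only Kk₀ λ Dx Ka x~a → ⊥-elim (only Ka λ Dy Kb y~b → same Dy Kb y~b Dx Ka x~a)
      where
      open Setup setup
      D = Reach R (Circuit.c C)

      same : ∀ {x y a b} → D x → K a → x ~ a → D y → K b → y ~ b → a ≡ b
      same {a = a} {b} Dx Ka x~a Dy Kb y~b = decidable-stable (a ≟ b) λ a≢b →
        noEar circuits setup size (sparse circuits setup size C)
          (ear Ka Kb (inj₁ a≢b) (~-sym x~a) (connecting-path Dx Dy) y~b)
          -- If both ends of the ear coincide, that vertex has the two neighbours `a` and `b` in
          -- `K`, against `sparse`.
          λ where
            refl → sparse circuits setup size C (reach-target Dx)
                     (more x~a Ka (more y~b (Kb , ≢-sym a≢b) none))

      only : ∀ {k} → K k → (∀ {x a} → D x → K a → x ~ a → a ≡ k) → ⊥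
      only {k} Kk unique =
        points {D} {k} (K∩R Kk ∘ reach-target) (here (All.head (Circuit.inside C)))
          (λ Dv → atLeast-mono (regroup Dv) (degree≥4 (reach-target Dv)))
          (λ xs! Dxs → size xs! (All.map reach-target Dxs))
        where
        regroup : ∀ {v x} → D v → v ~ x → (K ∪ R) x → ((_≡ k) ∪ D) x
        regroup Dv v~x (inj₁ Kx) = inj₁ (unique Dv Kx v~x)
        regroup Dv v~x (inj₂ Rx) =
          inj₂ (reach-trans Dv (there (reach-target Dv) v~x (here Rx)))

    mutual

      -- Passing to a component need not shrink `R`, so `noPoint` is called at the same bound; it in
      -- turn calls both claims only at smaller bounds.
      noCircuit : ∀ m → CircuitClaim m
      noCircuit zero _ _ size C with size ([] ∷ []) (All.head (Circuit.inside C) ∷ [])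
      ... | ()
      noCircuit (suc m) = circuit-step (noCircuit m) (noPoint (suc m))

      noPoint : ∀ m → PointClaim m
      noPoint zero _ Rr _ size with size ([] ∷ []) (Rr ∷ [])
      ... | ()
      noPoint (suc m) = point-step (noCircuit m) (noPoint m)

    -- From degrees to the point claim.

    -- The exempt vertex `x` is the starting point and `R` is everything else, inhabited by `r`.
    noHighDegree : ∀ {x r} → r ≢ x → (∀ {v} → v ≢ x → 4 ≤ degree v) → ⊥
    noHighDegree {x} r≢x high =
      noPoint n (λ x≢x → x≢x refl) r≢x
        (λ {v} v≢x → atLeast-mono (λ _ → either) (atLeast-≤ (high v≢x)
          (list⇒atLeast {S = λ _ → ⊤} (Unique.filter⁺ (v ~?_) (Unique.allFin⁺ n))
            (All.all-filter (v ~?_) (allFin n)) (All.universal _ _))))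
        (λ xs! _ → unique-length≤n xs!)
      where
      either : ∀ {y} → ⊤ → y ≡ x ⊎ y ≢ x
      either {y} _ with y ≟ x
      ... | yes y≡x = inj₁ y≡x
      ... | no y≢x = inj₂ y≢x

theorem4p7 : (n : ℕ) (G : Graph n) → 2 ≤ n → Graph.WheelFree G →
    ∃₂ λ (u v : Fin n) → u ≢ v × Graph.degree G u ≤ 3 × Graph.degree G v ≤ 3
theorem4p7 (suc zero) _ (s≤s ())
theorem4p7 (suc (suc n)) G _ wheelFree
  with any? (λ u → any? (λ v →
         ¬? (u ≟ v) ×-dec (Graph.degree G u ≤? 3) ×-dec (Graph.degree G v ≤? 3)))
... | yes low-pair = low-pair
... | no ¬low-pair with any? (λ x → Graph.degree G x ≤? 3)
-- Without a vertex of low degree, `zero` is exempted arbitrarily; otherwise the only such vertex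
-- `x` is.
... | no ¬low = ⊥-elim (noHighDegree G wheelFree {zero} {suc zero} (λ ())
                  λ {v} _ → ≰⇒> λ low-v → ¬low (v , low-v))
... | yes (x , low-x) = ⊥-elim (noHighDegree G wheelFree (proj₂ (other x))
                          λ {v} v≢x → ≰⇒> λ low-v → ¬low-pair (v , x , v≢x , low-v , low-x))
  where
  other : ∀ (x : Fin (suc (suc n))) → ∃ λ r → r ≢ x
  other zero = suc zero , λ ()
  other (suc _) = zero , λ ()
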